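{- Let $\sigma:{}^{<\omega}\omega\to\omega$ be suitable. Then $\mathscr C_{\mathcal M}\preceq\mathscr{ED}_\sigma\preceq\mathscr{ED}$. In particular all three relational systems have the same norm, and their duals have the same norm.
   Context: A relational system is a triple $\langle X,Y,R\rangle$ with $R\subseteq X\times Y$; its norm is the least cardinality of $B\subseteq Y$ such that for every $x\in X$ there is $y\in B$ with $(x,y)\in R$. Its dual is $\langle Y,X,R^\perp\rangle$ where $(y,x)\in R^\perp$ iff $(x,y)\notin R$. For systems $\langle X,Y,R\rangle$, $\langle X',Y',R'\rangle$, we write $\langle X,Y,R\rangle\preceq\langle X',Y',R'\rangle$ if there are maps $\rho_-:X\to X'$ and $\rho_+:Y'\to Y$ such that $(\rho_-(x),y')\in R'$ implies $(x,\rho_+(y'))\in R$ for all $x\in X$, $y'\in Y'$. Let $\mathcal M$ be the ideal of meagre subsets of ${}^\omega\omega$ and $\mathscr C_{\mathcal M}=\langle{}^\omega\omega,\mathcal M,\in\rangle$. Let $\mathscr{ED}=\langle{}^\omega\omega,{}^\omega\omega,R\rangle$ where $(x,y)\in R$ iff $x(k)=y(k)$ for only finitely many $k$. A function $\sigma:{}^{<\omega}\omega\to\omega$ is suitable if for every $s\in{}^{<\omega}\omega$ and $x\in{}^\omega\omega$ there are $k\in\omega$ and $t\in{}^k\omega$ with $s\subseteq t$ and $\sigma(t)=\sigma(x\restriction k)$. Let $\mathscr{ED}_\sigma=\langle{}^\omega\omega,{}^\omega\omega,R_\sigma\rangle$ where $(x,y)\in R_\sigma$ iff there are only finitely many $k\in\omega$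 such that both $x(k)=y(k)$ and $\sigma(x\restriction k)=\sigma(y\restriction k)$. -}

module Defs where

open import Level using (Level; _⊔_) renaming (suc to lsuc; zero to lzero)
open import Data.Nat using (ℕ; _≤_)
open import Data.List using (List; map; upTo; length; _++_)
open import Data.Product using (Σ; ∃; _×_)
open import Relation.Binary.PropositionalEquality using (_≡_; _≢_)
open import Relation.Nullary using (¬_)

Baire : Set
Baire = ℕ → ℕ

Seq : Set
Seq = List ℕ

_↾_ : Baire → ℕ → Seq
x ↾ k = map x (upTo k)

_⊑_ : Seq → Seq → Set
s ⊑ t = ∃ λ u → s ++ u ≡ t

Subset : Set₁
Subset = Baire → Set

NowhereDense : Subset → Set
NowhereDense A = (s : Seq) → Σ Seq λ t → s ⊑ t × ((x : Baire) → x ↾ length t ≡ t → ¬ A x)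

Meagre : Subset → Set₁
Meagre A = Σ (ℕ → Subset) λ F → ((n : ℕ) → NowhereDense (F n)) × ((x : Baire) → A x → ∃ λ n → F n x)

𝓜 : Set₁
𝓜 = Σ Subset Meagre

record RelSys (a b r : Level) : Set (lsuc (a ⊔ b ⊔ r)) where
  field
    X : Set a
    Y : Set b
    R : X → Y → Set r

open RelSys

_≼_ : ∀ {a b r a' b' r'} → RelSys a b r → RelSys a' b' r' → Set (a ⊔ b ⊔ r ⊔ a' ⊔ b' ⊔ r')
A ≼ B = Σ (X A → X B) λ ρ- → Σ (Y B → Y A) λ ρ+ →
          (x : X A) (y' : Y B) → R B (ρ- x) y' → R A x (ρ+ y')

dual : ∀ {a b r} → RelSys a b r → RelSys b a r
dual A = record { X = Y A ; Y = X A ; R = λ y x → ¬ R A x y }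

C𝓜 : RelSys lzero (lsuc lzero) lzero
C𝓜 = record { X = Baire ; Y = 𝓜 ; R = λ x A → Σ.proj₁ A x }
  where open import Data.Product using (module Σ)

ED : RelSys lzero lzero lzero
ED = record { X = Baire ; Y = Baire
            ; R = λ x y → ∃ λ n → (k : ℕ) → n ≤ k → x k ≢ y k }

Suitable : (Seq → ℕ) → Set
Suitable σ = (s : Seq) (x : Baire) →
  ∃ λ k → Σ Seq λ t → length t ≡ k × s ⊑ t × σ t ≡ σ (x ↾ k)

EDσ : (Seq → ℕ) → RelSys lzero lzero lzero
EDσ σ = record { X = Baire ; Y = Baire
               ; R = λ x y → ∃ λ n → (k : ℕ) → n ≤ k →
                       ¬ (x k ≡ y k × σ (x ↾ k) ≡ σ (y ↾ k)) }

{-# OPTIONS --safe #-}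
module Submission where

-- For fixed y, the x with x R_σ y form the union over n of the sets of x apart from y
-- (in value and in σ-value) at every k ≥ n. Each is nowhere dense: extend a basic open
-- [s] by suitability to some [t] with |t| ≥ n and σ t = σ (y ↾ |t|), then append y |t|;
-- every x in the resulting basic open agrees with y at k = |t| in both senses. So x ↦ x
-- and y ↦ {x | x R_σ y} form a Tukey connection from 𝒞_𝓜, while the second connection
-- is the identity, since agreeing in both senses implies agreeing in value.

open import Level using (0ℓ)
open import Data.Nat using (ℕ; suc; _≤_)
open import Data.Nat.Properties using (≤-trans; +-comm)
open import Data.Product using (_×_; _,_; ∃)
open import Data.List using ([_]; _++_; _∷ʳ_; map; upTo; length; replicate)
open import Data.List.Properties
  using (upTo-∷ʳ; map-++; ∷ʳ-injective; ++-assoc; length-++; length-++-≤ˡ; length-++-≤ʳ; length-replicate)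
open import Relation.Binary.PropositionalEquality
  using (_≡_; refl; sym; trans; cong; subst; module ≡-Reasoning)
open import Relation.Nullary using (¬_)
open import Defs

open RelSys

↾-suc : (x : Baire) (k : ℕ) → x ↾ suc k ≡ (x ↾ k) ∷ʳ x k
↾-suc x k = trans (cong (map x) (sym (upTo-∷ʳ k))) (map-++ x (upTo k) [ k ])

length-∷ʳ : (t : Seq) (a : ℕ) → length (t ∷ʳ a) ≡ suc (length t)
length-∷ʳ t a = trans (length-++ t) (+-comm (length t) 1)

↾-∷ʳ⁻ : (x : Baire) (t : Seq) (a : ℕ) →
        x ↾ length (t ∷ʳ a) ≡ t ∷ʳ a → x ↾ length t ≡ t × x (length t) ≡ a
↾-∷ʳ⁻ x t a x↾≡ = ∷ʳ-injective (x ↾ length t) t (begin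
  (x ↾ length t) ∷ʳ x (length t)  ≡⟨ sym (↾-suc x (length t)) ⟩
  x ↾ suc (length t)              ≡⟨ cong (x ↾_) (sym (length-∷ʳ t a)) ⟩
  x ↾ length (t ∷ʳ a)             ≡⟨ x↾≡ ⟩
  t ∷ʳ a                          ∎)
  where open ≡-Reasoning

⊑-trans : {r s t : Seq} → r ⊑ s → s ⊑ t → r ⊑ t
⊑-trans {r} (u , refl) (v , refl) = u ++ v , sym (++-assoc r u v)

⊑-length : {s t : Seq} → s ⊑ t → length s ≤ length t
⊑-length {s} (u , refl) = length-++-≤ˡ s

suitable-beyond : {σ : Seq → ℕ} → Suitable σ → (s : Seq) (y : Baire) (n : ℕ) →
                  ∃ λ t → s ⊑ t × n ≤ length t × σ t ≡ σ (y ↾ length t)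
suitable-beyond suit s y n with suit (s ++ replicate n 0) y
... | _ , t , refl , s⁺⊑t , σt≡ =
  t , ⊑-trans (replicate n 0 , refl) s⁺⊑t , ≤-trans n≤|s⁺| (⊑-length s⁺⊑t) , σt≡
  where
  n≤|s⁺| : n ≤ length (s ++ replicate n 0)
  n≤|s⁺| = subst (_≤ length (s ++ replicate n 0)) (length-replicate n) (length-++-≤ʳ (replicate n 0) {s})

ApartFrom : (σ : Seq → ℕ) → Baire → ℕ → Subset
ApartFrom σ y n x = (k : ℕ) → n ≤ k → ¬ (x k ≡ y k × σ (x ↾ k) ≡ σ (y ↾ k))

ApartFrom-nowhereDense : {σ : Seq → ℕ} → Suitable σ → (y : Baire) (n : ℕ) →
                         NowhereDense (ApartFrom σ y n)
ApartFrom-nowhereDense {σ} suit y n s with suitable-beyond suit s y n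
... | t , s⊑t , n≤|t| , σt≡ = t ∷ʳ y (length t) , ⊑-trans s⊑t ([ y (length t) ] , refl) , disjoint
  where
  disjoint : (x : Baire) → x ↾ length (t ∷ʳ y (length t)) ≡ t ∷ʳ y (length t) →
             ¬ ApartFrom σ y n x
  disjoint x x↾≡ apart with ↾-∷ʳ⁻ x t (y (length t)) x↾≡
  ... | x↾≡t , x≡y = apart (length t) n≤|t| (x≡y , trans (cong σ x↾≡t) σt≡)

EDσ-related-meagre : {σ : Seq → ℕ} → Suitable σ → (y : Baire) → Meagre (λ x → R (EDσ σ) x y)
EDσ-related-meagre {σ} suit y = ApartFrom σ y , ApartFrom-nowhereDense suit y , λ x x∈ → x∈

C𝓜-≼-of-meagre : ∀ {b} (S : RelSys 0ℓ b 0ℓ) (ι : Baire → X S) →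
                 ((y : Y S) → Meagre (λ x → R S (ι x) y)) → C𝓜 ≼ S
C𝓜-≼-of-meagre S ι meagre = ι , (λ y → (λ x → R S (ι x) y) , meagre y) , λ x y x∈ → x∈

EDσ≼ED : (σ : Seq → ℕ) → EDσ σ ≼ ED
EDσ≼ED σ = (λ x → x) , (λ y → y) , λ x y (n , apart) → n , λ k n≤k (xk≡yk , _) → apart k n≤k xk≡yk

mainTheorem6 : (σ : Seq → ℕ) → Suitable σ → (C𝓜 ≼ EDσ σ) × (EDσ σ ≼ ED)
mainTheorem6 σ suit = C𝓜-≼-of-meagre (EDσ σ) (λ x → x) (EDσ-related-meagre suit) , EDσ≼ED σ
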